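{- Let $R$ be a ring with $1$ and let $\lambda$ be a lattice identity. Then $\lambda$ holds in the submodule lattice $\mathrm{Sub}\,M$ for every unital left $R$-module $M$ if and only if the dual of $\lambda$ holds in $\mathrm{Sub}\,M$ for every unital left $R$-module $M$.
   Context: $\mathrm{Sub}\,M$ is the lattice of submodules of $M$ with $X\wedge Y=X\cap Y$ and $X\vee Y=X+Y$. A lattice term is built from variables using $\vee$ and $\wedge$; a lattice identity is $p=q$ (universally quantified) for lattice terms $p,q$. The dual of a term is obtained by interchanging $\vee$ and $\wedge$; the dual of an identity is obtained by dualizing both sides. -}

module Defs where

open import Algebra.Bundles using (CommutativeMonoid; Ring)
open import Algebra.Module.Bundles using (LeftModule)
open import Data.Nat.Base using (ℕ)
open import Data.Product.Base using (_×_; _,_; proj₁; proj₂; ∃₂; swap)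
open import Function.Base using (id)
open import Level using (Level; _⊔_; suc)
open import Relation.Binary.Definitions using (_Respects_)
open import Relation.Binary.Lattice.Bundles using (Lattice)
open import Relation.Unary using (Pred; _∈_; _⊆_; _≐_; _∩_)

data Term : Set where
  var  : ℕ → Term
  _∨ᵗ_ : Term → Term → Term
  _∧ᵗ_ : Term → Term → Term

infixr 6 _∨ᵗ_
infixr 7 _∧ᵗ_

dualᵗ : Term → Term
dualᵗ (var i)  = var i
dualᵗ (s ∨ᵗ t) = dualᵗ s ∧ᵗ dualᵗ t
dualᵗ (s ∧ᵗ t) = dualᵗ s ∨ᵗ dualᵗ t

infix 4 _≈ᵗ_

record Identity : Set where
  constructor _≈ᵗ_
  field
    lhs rhs : Term

dual : Identity → Identity
dual (p ≈ᵗ q) = dualᵗ p ≈ᵗ dualᵗ q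

module _ {a ℓ₁ ℓ₂ : Level} (L : Lattice a ℓ₁ ℓ₂) where
  open Lattice L

  ⟦_⟧ : Term → (ℕ → Carrier) → Carrier
  ⟦ var i ⟧  ρ = ρ i
  ⟦ s ∨ᵗ t ⟧ ρ = ⟦ s ⟧ ρ ∨ ⟦ t ⟧ ρ
  ⟦ s ∧ᵗ t ⟧ ρ = ⟦ s ⟧ ρ ∧ ⟦ t ⟧ ρ

  infix 4 _⊨_

  _⊨_ : Identity → Set (a ⊔ ℓ₁)
  _⊨_ (p ≈ᵗ q) = (ρ : ℕ → Carrier) → ⟦ p ⟧ ρ ≈ ⟦ q ⟧ ρ

module _ {c ℓ m ℓm : Level} {R : Ring c ℓ} (M : LeftModule R m ℓm) where
  open Ring R using () renaming (Carrier to ∣R∣)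
  open LeftModule M

  -- Closure under -ᴹ_ follows from closure under scalars, as M is unital.
  -- The level of the predicate is the least one closed under sums of
  -- submodules, which quantify over M and its equality.
  record Submodule : Set (c ⊔ suc (m ⊔ ℓm)) where
    field
      pred      : Pred Carrierᴹ (m ⊔ ℓm)
      resp      : pred Respects _≈ᴹ_
      0-closed  : 0ᴹ ∈ pred
      +-closed  : ∀ {x y} → x ∈ pred → y ∈ pred → x +ᴹ y ∈ pred
      *ₗ-closed : ∀ (r : ∣R∣) {x} → x ∈ pred → r *ₗ x ∈ pred

  open Submodule

  _⊓_ : Submodule → Submodule → Submodule
  X ⊓ Y = record
    { pred      = pred X ∩ pred Y
    ; resp      = λ x≈y (x∈X , x∈Y) → resp X x≈y x∈X , resp Y x≈y x∈Y
    ; 0-closed  = 0-closed X , 0-closed Y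
    ; +-closed  = λ (x∈X , x∈Y) (y∈X , y∈Y) → +-closed X x∈X y∈X , +-closed Y x∈Y y∈Y
    ; *ₗ-closed = λ r (x∈X , x∈Y) → *ₗ-closed X r x∈X , *ₗ-closed Y r x∈Y
    }

  _⊹_ : Submodule → Submodule → Submodule
  X ⊹ Y = record
    { pred      = λ z → ∃₂ λ x y → x ∈ pred X × y ∈ pred Y × z ≈ᴹ x +ᴹ y
    ; resp      = λ z≈w (x , y , x∈X , y∈Y , z≈x+y) →
        x , y , x∈X , y∈Y , ≈ᴹ-trans (≈ᴹ-sym z≈w) z≈x+y
    ; 0-closed  =
        0ᴹ , 0ᴹ , 0-closed X , 0-closed Y , ≈ᴹ-sym (+ᴹ-identityˡ 0ᴹ)
    ; +-closed  = λ (x , y , x∈X , y∈Y , z≈) (x′ , y′ , x′∈X , y′∈Y , w≈) →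
        x +ᴹ x′ , y +ᴹ y′ , +-closed X x∈X x′∈X , +-closed Y y∈Y y′∈Y ,
        ≈ᴹ-trans (+ᴹ-cong z≈ w≈) (interchange x y x′ y′)
    ; *ₗ-closed = λ r (x , y , x∈X , y∈Y , z≈) →
        r *ₗ x , r *ₗ y , *ₗ-closed X r x∈X , *ₗ-closed Y r y∈Y ,
        ≈ᴹ-trans (*ₗ-congˡ z≈) (*ₗ-distribˡ r x y)
    }
    where
    open import Algebra.Properties.CommutativeSemigroup
      (CommutativeMonoid.commutativeSemigroup +ᴹ-commutativeMonoid)
      using (interchange)

  Sub : Lattice (c ⊔ suc (m ⊔ ℓm)) (m ⊔ ℓm) (m ⊔ ℓm)
  Sub = record
    { Carrier   = Submodule
    ; _≈_       = λ X Y → pred X ≐ pred Y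
    ; _≤_       = λ X Y → pred X ⊆ pred Y
    ; _∨_       = _⊹_
    ; _∧_       = _⊓_
    ; isLattice = record
      { isPartialOrder = record
        { isPreorder = record
          { isEquivalence = record
            { refl  = id , id
            ; sym   = swap
            ; trans = λ (f , f′) (g , g′) → (λ x∈ → g (f x∈)) , (λ x∈ → f′ (g′ x∈))
            }
          ; reflexive = proj₁
          ; trans     = λ f g x∈ → g (f x∈)
          }
        ; antisym = _,_
        }
      ; supremum = λ X Y →
          (λ {x} x∈X → x , 0ᴹ , x∈X , 0-closed Y , ≈ᴹ-sym (+ᴹ-identityʳ x))
        , (λ {y} y∈Y → 0ᴹ , y , 0-closed X , y∈Y , ≈ᴹ-sym (+ᴹ-identityˡ y))
        , λ Z X⊆Z Y⊆Z (x , y , x∈X , y∈Y , z≈) →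
            resp Z (≈ᴹ-sym z≈) (+-closed Z (X⊆Z x∈X) (Y⊆Z y∈Y))
      ; infimum  = λ X Y →
          proj₁ , proj₂ , λ Z Z⊆X Z⊆Y z∈Z → Z⊆X z∈Z , Z⊆Y z∈Z
      }
    }

{-# OPTIONS --safe #-}

-- Fix a module M with submodules X i. For any module C, the additive maps
-- M → C form a left R-module Hom M C, R acting on the values, and the maps
-- vanishing on X i form a submodule Y i. Two facts give p ≤ q ⇒ qᵈ ≤ pᵈ:
-- every F in q(Y) vanishes on qᵈ(X), for any C; and for a suitable C some
-- F in p(Y) vanishes only on pᵈ(X). The second C is built along p: M / X i for
-- a variable, the product for a join, and the pushout under M for a meet.
-- That Hom M C consists of additive rather than R-linear maps keeps it a left
-- module when R is not commutative.
module Submission where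

open import Defs
open import Algebra.Bundles using (CommutativeMonoid; Ring)
open import Algebra.Module.Bundles using (LeftModule)
open import Algebra.Module.Construct.DirectProduct using (leftModule)
import Algebra.Properties.AbelianGroup as AbelianGroupProperties
import Algebra.Properties.CommutativeSemigroup as CommutativeSemigroupProperties
open import Data.Nat.Base using (ℕ)
open import Data.Product.Base using (_,_; proj₁; proj₂; ∃)
open import Function.Base using (id)
open import Function.Bundles using (_⇔_; mk⇔)
open import Level using (Level; _⊔_; suc)
open import Relation.Binary.PropositionalEquality using (_≡_; refl; cong₂; subst)
import Relation.Binary.Reasoning.Setoid as SetoidReasoning
open import Relation.Unary using (_∈_; _⊆_)

open Submodule

-- Double dualization of terms and identities.

dualᵗ-involutive : ∀ t → dualᵗ (dualᵗ t) ≡ t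
dualᵗ-involutive (var i)  = refl
dualᵗ-involutive (s ∨ᵗ t) = cong₂ _∨ᵗ_ (dualᵗ-involutive s) (dualᵗ-involutive t)
dualᵗ-involutive (s ∧ᵗ t) = cong₂ _∧ᵗ_ (dualᵗ-involutive s) (dualᵗ-involutive t)

dual-involutive : ∀ e → dual (dual e) ≡ e
dual-involutive (p ≈ᵗ q) = cong₂ _≈ᵗ_ (dualᵗ-involutive p) (dualᵗ-involutive q)

module _ {c ℓ : Level} {R : Ring c ℓ} where
  private module R = Ring R

  -- Arithmetic in modules, and quotient modules.

  module ModuleProperties {m ℓm : Level} (M : LeftModule R m ℓm) where
    open LeftModule M
    open AbelianGroupProperties +ᴹ-abelianGroup public
    open CommutativeSemigroupProperties
      (CommutativeMonoid.commutativeSemigroup +ᴹ-commutativeMonoid) public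
      using (interchange)
    open SetoidReasoning ≈ᴹ-setoid

    infixl 6 _-ᴹ_
    _-ᴹ_ : Carrierᴹ → Carrierᴹ → Carrierᴹ
    x -ᴹ y = x +ᴹ -ᴹ y

    -1*x≈-x : ∀ x → (R.- R.1#) *ₗ x ≈ᴹ -ᴹ x
    -1*x≈-x x = inverseʳ-unique x _ (begin
      x +ᴹ (R.- R.1#) *ₗ x            ≈⟨ +ᴹ-congʳ (*ₗ-identityˡ x) ⟨
      R.1# *ₗ x +ᴹ (R.- R.1#) *ₗ x    ≈⟨ *ₗ-distribʳ x R.1# _ ⟨
      (R.1# R.+ R.- R.1#) *ₗ x        ≈⟨ *ₗ-congʳ (R.-‿inverseʳ R.1#) ⟩
      R.0# *ₗ x                       ≈⟨ *ₗ-zeroˡ x ⟩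
      0ᴹ                              ∎)

    *ₗ-neg : ∀ r x → r *ₗ (-ᴹ x) ≈ᴹ -ᴹ (r *ₗ x)
    *ₗ-neg r x = inverseʳ-unique (r *ₗ x) _ (begin
      r *ₗ x +ᴹ r *ₗ (-ᴹ x)    ≈⟨ *ₗ-distribˡ r x (-ᴹ x) ⟨
      r *ₗ (x -ᴹ x)            ≈⟨ *ₗ-congˡ (-ᴹ‿inverseʳ x) ⟩
      r *ₗ 0ᴹ                  ≈⟨ *ₗ-zeroʳ r ⟩
      0ᴹ                       ∎)

    *ₗ-distribˡ-- : ∀ r x y → r *ₗ (x -ᴹ y) ≈ᴹ r *ₗ x -ᴹ r *ₗ y
    *ₗ-distribˡ-- r x y = ≈ᴹ-trans (*ₗ-distribˡ r x (-ᴹ y)) (+ᴹ-congˡ (*ₗ-neg r y))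

    telescope : ∀ x y z → (x -ᴹ y) +ᴹ (y -ᴹ z) ≈ᴹ x -ᴹ z
    telescope x y z = begin
      (x -ᴹ y) +ᴹ (y -ᴹ z)      ≈⟨ +ᴹ-assoc (x -ᴹ y) y (-ᴹ z) ⟨
      (x -ᴹ y) +ᴹ y -ᴹ z        ≈⟨ +ᴹ-congʳ (//-rightDividesˡ y x) ⟩
      x -ᴹ z                    ∎

    +-‿interchange : ∀ x y x′ y′ →
      (x -ᴹ y) +ᴹ (x′ -ᴹ y′) ≈ᴹ (x +ᴹ x′) -ᴹ (y +ᴹ y′)
    +-‿interchange x y x′ y′ =
      ≈ᴹ-trans (interchange x (-ᴹ y) x′ (-ᴹ y′)) (+ᴹ-congˡ (⁻¹-∙-comm y y′))

    x-0≈x : ∀ x → x -ᴹ 0ᴹ ≈ᴹ x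
    x-0≈x x = ≈ᴹ-trans (+ᴹ-congˡ ε⁻¹≈ε) (+ᴹ-identityʳ x)

    -- Negation is scaling by -1. Symmetry of congruence modulo `Q` rests on this.
    -ᴹ-closed : (Q : Submodule M) → ∀ {x} → x ∈ pred Q → -ᴹ x ∈ pred Q
    -ᴹ-closed Q x∈Q = resp Q (-1*x≈-x _) (*ₗ-closed Q (R.- R.1#) x∈Q)

  -- The quotient keeps the carrier of `M` and only coarsens its equality. Membership in `Q` lives
  -- at level `m ⊔ ℓm`, hence the level of the new equality; for `m = ℓm = a` the quotient stays in
  -- `LeftModule R a a`.
  _/ᴹ_ : ∀ {m ℓm} (M : LeftModule R m ℓm) → Submodule M → LeftModule R m (m ⊔ ℓm)
  M /ᴹ Q = record
    { _≈ᴹ_ = _∼_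
    ; _+ᴹ_ = _+ᴹ_
    ; _*ₗ_ = _*ₗ_
    ; 0ᴹ   = 0ᴹ
    ; -ᴹ_  = -ᴹ_
    ; isLeftModule = record
      { isLeftSemimodule = record
        { +ᴹ-isCommutativeMonoid = record
          { isMonoid = record
            { isSemigroup = record
              { isMagma = record
                { isEquivalence = record
                  { refl  = ≈⇒∼ ≈ᴹ-refl
                  ; sym   = λ x∼y → resp Q (⁻¹-anti-homo‿- _ _) (-ᴹ-closed Q x∼y)
                  ; trans = ∼-trans
                  }
                ; ∙-cong = λ x∼y x′∼y′ →
                    resp Q (+-‿interchange _ _ _ _) (+-closed Q x∼y x′∼y′)
                }
              ; assoc = λ x y z → ≈⇒∼ (+ᴹ-assoc x y z)
              }
            ; identity = (λ x → ≈⇒∼ (+ᴹ-identityˡ x)) , (λ x → ≈⇒∼ (+ᴹ-identityʳ x))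
            }
          ; comm = λ x y → ≈⇒∼ (+ᴹ-comm x y)
          }
        ; isPreleftSemimodule = record
          { *ₗ-cong      = λ {r} {s} {x} {y} r≈s x∼y → ∼-trans
              (resp Q (*ₗ-distribˡ-- r x y) (*ₗ-closed Q r x∼y))
              (≈⇒∼ (*ₗ-congʳ r≈s))
          ; *ₗ-zeroˡ     = λ x → ≈⇒∼ (*ₗ-zeroˡ x)
          ; *ₗ-distribʳ  = λ x r s → ≈⇒∼ (*ₗ-distribʳ x r s)
          ; *ₗ-identityˡ = λ x → ≈⇒∼ (*ₗ-identityˡ x)
          ; *ₗ-assoc     = λ r s x → ≈⇒∼ (*ₗ-assoc r s x)
          ; *ₗ-zeroʳ     = λ r → ≈⇒∼ (*ₗ-zeroʳ r)
          ; *ₗ-distribˡ  = λ r x y → ≈⇒∼ (*ₗ-distribˡ r x y)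
          }
        }
      ; -ᴹ‿cong    = λ x∼y → resp Q (≈ᴹ-sym (⁻¹-∙-comm _ _)) (-ᴹ-closed Q x∼y)
      ; -ᴹ‿inverse = (λ x → ≈⇒∼ (-ᴹ‿inverseˡ x)) , (λ x → ≈⇒∼ (-ᴹ‿inverseʳ x))
      }
    }
    where
    open LeftModule M
    open ModuleProperties M

    _∼_ : Carrierᴹ → Carrierᴹ → Set _
    x ∼ y = x -ᴹ y ∈ pred Q

    ≈⇒∼ : ∀ {x y} → x ≈ᴹ y → x ∼ y
    ≈⇒∼ x≈y = resp Q (≈ᴹ-sym (x≈y⇒x∙y⁻¹≈ε x≈y)) (0-closed Q)

    ∼-trans : ∀ {x y z} → x ∼ y → y ∼ z → x ∼ z
    ∼-trans x∼y y∼z = resp Q (telescope _ _ _) (+-closed Q x∼y y∼z)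

  -- Additive maps and the modules they form.

  record AdditiveMap {m ℓm n ℓn : Level}
                     (M : LeftModule R m ℓm) (N : LeftModule R n ℓn)
                     : Set (m ⊔ ℓm ⊔ n ⊔ ℓn) where
    private
      module M = LeftModule M
      module N = LeftModule N
    field
      fun    : M.Carrierᴹ → N.Carrierᴹ
      cong   : ∀ {x y} → x M.≈ᴹ y → fun x N.≈ᴹ fun y
      +-homo : ∀ x y → fun (x M.+ᴹ y) N.≈ᴹ fun x N.+ᴹ fun y

    private module P = ModuleProperties N
    open SetoidReasoning N.≈ᴹ-setoid

    0-homo : fun M.0ᴹ N.≈ᴹ N.0ᴹ
    0-homo = P.identityʳ-unique _ _ (begin
      fun M.0ᴹ N.+ᴹ fun M.0ᴹ  ≈⟨ +-homo M.0ᴹ M.0ᴹ ⟨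
      fun (M.0ᴹ M.+ᴹ M.0ᴹ)    ≈⟨ cong (M.+ᴹ-identityˡ M.0ᴹ) ⟩
      fun M.0ᴹ                ∎)

    -‿homo : ∀ x → fun (M.-ᴹ x) N.≈ᴹ N.-ᴹ fun x
    -‿homo x = P.inverseʳ-unique (fun x) _ (begin
      fun x N.+ᴹ fun (M.-ᴹ x)  ≈⟨ +-homo x (M.-ᴹ x) ⟨
      fun (x M.+ᴹ M.-ᴹ x)      ≈⟨ cong (M.-ᴹ‿inverseʳ x) ⟩
      fun M.0ᴹ                 ≈⟨ 0-homo ⟩
      N.0ᴹ                     ∎)

  open AdditiveMap

  quotientMap : ∀ {m ℓm} (M : LeftModule R m ℓm) (Q : Submodule M) → AdditiveMap M (M /ᴹ Q)
  quotientMap M Q = record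
    { fun    = id
    ; cong   = ≈⇒∼
    ; +-homo = λ _ _ → ≈⇒∼ (LeftModule.≈ᴹ-refl M)
    }
    where
    open LeftModule M using (≈ᴹ-sym)
    open ModuleProperties M
    ≈⇒∼ : ∀ {x y} → LeftModule._≈ᴹ_ M x y → LeftModule._≈ᴹ_ (M /ᴹ Q) x y
    ≈⇒∼ x≈y = resp Q (≈ᴹ-sym (x≈y⇒x∙y⁻¹≈ε x≈y)) (0-closed Q)

  infixr 9 _∘ᴬ_
  _∘ᴬ_ : ∀ {m ℓm n ℓn k ℓk} {M : LeftModule R m ℓm} {N : LeftModule R n ℓn}
         {K : LeftModule R k ℓk} → AdditiveMap N K → AdditiveMap M N → AdditiveMap M K
  _∘ᴬ_ {K = K} G F = record
    { fun    = λ x → fun G (fun F x)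
    ; cong   = λ x≈y → cong G (cong F x≈y)
    ; +-homo = λ x y → LeftModule.≈ᴹ-trans K (cong G (+-homo F x y)) (+-homo G _ _)
    }

  -- When all four levels are `a`, the result is again in `LeftModule R a a`, so an identity assumed
  -- for such modules can be evaluated in `Sub (Hom M C)`.
  Hom : ∀ {m ℓm n ℓn} → LeftModule R m ℓm → LeftModule R n ℓn →
        LeftModule R (m ⊔ ℓm ⊔ n ⊔ ℓn) (m ⊔ ℓn)
  Hom M N = record
    { Carrierᴹ = AdditiveMap M N
    ; _≈ᴹ_ = λ F G → ∀ x → fun F x ≈ᴹ fun G x
    ; _+ᴹ_ = λ F G → record
      { fun    = λ x → fun F x +ᴹ fun G x
      ; cong   = λ x≈y → +ᴹ-cong (cong F x≈y) (cong G x≈y)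
      ; +-homo = λ x y →
          ≈ᴹ-trans (+ᴹ-cong (+-homo F x y) (+-homo G x y)) (interchange _ _ _ _)
      }
    ; _*ₗ_ = λ r F → record
      { fun    = λ x → r *ₗ fun F x
      ; cong   = λ x≈y → *ₗ-congˡ (cong F x≈y)
      ; +-homo = λ x y → ≈ᴹ-trans (*ₗ-congˡ (+-homo F x y)) (*ₗ-distribˡ r _ _)
      }
    ; 0ᴹ = record
      { fun    = λ _ → 0ᴹ
      ; cong   = λ _ → ≈ᴹ-refl
      ; +-homo = λ _ _ → ≈ᴹ-sym (+ᴹ-identityˡ 0ᴹ)
      }
    ; -ᴹ_ = λ F → record
      { fun    = λ x → -ᴹ fun F x
      ; cong   = λ x≈y → -ᴹ‿cong (cong F x≈y)
      ; +-homo = λ x y → ≈ᴹ-trans (-ᴹ‿cong (+-homo F x y)) (≈ᴹ-sym (⁻¹-∙-comm _ _))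
      }
    ; isLeftModule = record
      { isLeftSemimodule = record
        { +ᴹ-isCommutativeMonoid = record
          { isMonoid = record
            { isSemigroup = record
              { isMagma = record
                { isEquivalence = record
                  { refl  = λ _ → ≈ᴹ-refl
                  ; sym   = λ F≈G x → ≈ᴹ-sym (F≈G x)
                  ; trans = λ F≈G G≈H x → ≈ᴹ-trans (F≈G x) (G≈H x)
                  }
                ; ∙-cong = λ F≈G F≈G′ x → +ᴹ-cong (F≈G x) (F≈G′ x)
                }
              ; assoc = λ F G H x → +ᴹ-assoc _ _ _
              }
            ; identity = (λ F x → +ᴹ-identityˡ _) , (λ F x → +ᴹ-identityʳ _)
            }
          ; comm = λ F G x → +ᴹ-comm _ _
          }
        ; isPreleftSemimodule = record
          { *ₗ-cong      = λ r≈s F≈G x → *ₗ-cong r≈s (F≈G x)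
          ; *ₗ-zeroˡ     = λ F x → *ₗ-zeroˡ _
          ; *ₗ-distribʳ  = λ F r s x → *ₗ-distribʳ _ r s
          ; *ₗ-identityˡ = λ F x → *ₗ-identityˡ _
          ; *ₗ-assoc     = λ r s F x → *ₗ-assoc r s _
          ; *ₗ-zeroʳ     = λ r x → *ₗ-zeroʳ r
          ; *ₗ-distribˡ  = λ r F G x → *ₗ-distribˡ r _ _
          }
        }
      ; -ᴹ‿cong    = λ F≈G x → -ᴹ‿cong (F≈G x)
      ; -ᴹ‿inverse = (λ F x → -ᴹ‿inverseˡ _) , (λ F x → -ᴹ‿inverseʳ _)
      }
    }
    where
    open LeftModule N
    open ModuleProperties N

  -- Annihilators, and terms evaluated at them.

  module Duality {a : Level} (M : LeftModule R a a) (X : ℕ → Submodule M) where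
    private module M = LeftModule M

    Ann : (C : LeftModule R a a) → Submodule M → Submodule (Hom M C)
    Ann C X = record
      { pred      = λ F → ∀ x → x ∈ pred X → fun F x ≈ᴹ 0ᴹ
      ; resp      = λ F≈G F∈ x x∈X → ≈ᴹ-trans (≈ᴹ-sym (F≈G x)) (F∈ x x∈X)
      ; 0-closed  = λ _ _ → ≈ᴹ-refl
      ; +-closed  = λ F∈ G∈ x x∈X →
          ≈ᴹ-trans (+ᴹ-cong (F∈ x x∈X) (G∈ x x∈X)) (+ᴹ-identityˡ 0ᴹ)
      ; *ₗ-closed = λ r F∈ x x∈X → ≈ᴹ-trans (*ₗ-congˡ (F∈ x x∈X)) (*ₗ-zeroʳ r)
      }
      where open LeftModule C


    value : Term → Submodule M
    value t = ⟦_⟧ (Sub M) t X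

    annValue : (C : LeftModule R a a) → Term → Submodule (Hom M C)
    annValue C t = ⟦_⟧ (Sub (Hom M C)) t (λ i → Ann C (X i))

    -- Induction on the term. At a join, F splits as G + H, and both summands vanish on the
    -- intersection of the two dual values. At a meet, F vanishes on both dual values, hence by
    -- additivity on their sum.
    annValue-vanishes : ∀ (C : LeftModule R a a) t {F} → F ∈ pred (annValue C t) →
      F ∈ pred (Ann C (value (dualᵗ t)))
    annValue-vanishes C (var i) F∈ = F∈
    annValue-vanishes C (s ∨ᵗ t) (G , H , G∈ , H∈ , F≈G+H) y (y∈s , y∈t) =
      ≈ᴹ-trans (F≈G+H y) (≈ᴹ-trans
        (+ᴹ-cong (annValue-vanishes C s G∈ y y∈s) (annValue-vanishes C t H∈ y y∈t))
        (+ᴹ-identityˡ 0ᴹ))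
      where open LeftModule C
    annValue-vanishes C (s ∧ᵗ t) {F} (F∈s , F∈t) y (b , d , b∈s , d∈t , y≈b+d) =
      ≈ᴹ-trans (cong F y≈b+d) (≈ᴹ-trans (+-homo F b d) (≈ᴹ-trans
        (+ᴹ-cong (annValue-vanishes C s F∈s b b∈s) (annValue-vanishes C t F∈t d d∈t))
        (+ᴹ-identityˡ 0ᴹ)))
      where open LeftModule C

    -- Composing with `G` preserves sums of maps and vanishing on each `X i`. This carries a member
    -- found for a subterm into the larger target built for the whole term.
    annValue-∘ : ∀ {C D : LeftModule R a a} (G : AdditiveMap C D) t {F} →
      F ∈ pred (annValue C t) → (G ∘ᴬ F) ∈ pred (annValue D t)
    annValue-∘ {D = D} G (var i) F∈ x x∈X =
      LeftModule.≈ᴹ-trans D (cong G (F∈ x x∈X)) (0-homo G)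
    annValue-∘ {D = D} G (s ∨ᵗ t) (H , K , H∈ , K∈ , F≈H+K) =
      G ∘ᴬ H , G ∘ᴬ K , annValue-∘ G s H∈ , annValue-∘ G t K∈ ,
      λ x → LeftModule.≈ᴹ-trans D (cong G (F≈H+K x)) (+-homo G _ _)
    annValue-∘ G (s ∧ᵗ t) (F∈s , F∈t) = annValue-∘ G s F∈s , annValue-∘ G t F∈t

    -- Separating maps, built along a term.

    record Separator (t : Term) : Set (c ⊔ ℓ ⊔ suc a) where
      field
        target : LeftModule R a a
      open LeftModule target
      field
        map     : AdditiveMap M target
        -- Linearity makes the range of `pairing` a submodule, so that the pushout can be formed.
        *-homo  : ∀ r x → fun map (r M.*ₗ x) ≈ᴹ r *ₗ fun map x
        member  : map ∈ pred (annValue target t)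
        kernel  : ∀ {y} → fun map y ≈ᴹ 0ᴹ → y ∈ pred (value (dualᵗ t))

    separator-var : ∀ i → Separator (var i)
    separator-var i = record
      { target = M /ᴹ X i
      ; map    = quotientMap M (X i)
      ; *-homo = λ _ _ → LeftModule.≈ᴹ-refl (M /ᴹ X i)
      -- To be zero in the quotient is to have x - 0 in `X i`.
      ; member = λ x x∈X → resp (X i) (M.≈ᴹ-sym (x-0≈x x)) x∈X
      ; kernel = λ {y} y∼0 → resp (X i) (x-0≈x y) y∼0
      }
      where open ModuleProperties M

    module _ {s t : Term} (S : Separator s) (T : Separator t) where
      private
        module S = Separator S
        module T = Separator T
        module C = LeftModule S.target
        module D = LeftModule T.target
        C×D = leftModule S.target T.target
        module C×D = LeftModule C×D

      inl : AdditiveMap S.target C×D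
      inl = record
        { fun    = λ x → x , D.0ᴹ
        ; cong   = λ x≈y → x≈y , D.≈ᴹ-refl
        ; +-homo = λ _ _ → C.≈ᴹ-refl , D.≈ᴹ-sym (D.+ᴹ-identityˡ D.0ᴹ)
        }

      inr : AdditiveMap T.target C×D
      inr = record
        { fun    = λ x → C.0ᴹ , x
        ; cong   = λ x≈y → C.≈ᴹ-refl , x≈y
        ; +-homo = λ _ _ → C.≈ᴹ-sym (C.+ᴹ-identityˡ C.0ᴹ) , D.≈ᴹ-refl
        }

      pairing : AdditiveMap M C×D
      pairing = record
        { fun    = λ x → fun S.map x , fun T.map x
        ; cong   = λ x≈y → cong S.map x≈y , cong T.map x≈y
        ; +-homo = λ x y → +-homo S.map x y , +-homo T.map x y
        }

      -- The pairing is the sum of its two components, one a member for `s` and the other for `t`.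
      -- It kills only what both components kill, which matches the meet dual to the join.
      separator-∨ : Separator (s ∨ᵗ t)
      separator-∨ = record
        { target = C×D
        ; map    = pairing
        ; *-homo = λ r x → S.*-homo r x , T.*-homo r x
        ; member =
            inl ∘ᴬ S.map , inr ∘ᴬ T.map , annValue-∘ inl s S.member , annValue-∘ inr t T.member ,
            λ x → C.≈ᴹ-sym (C.+ᴹ-identityʳ _) , D.≈ᴹ-sym (D.+ᴹ-identityˡ _)
        ; kernel = λ (Sy≈0 , Ty≈0) → S.kernel Sy≈0 , T.kernel Ty≈0
        }

      range : Submodule C×D
      range = record
        { pred      = λ z → ∃ λ x → z C×D.≈ᴹ fun pairing x
        ; resp      = λ z≈w (x , z≈Fx) → x , C×D.≈ᴹ-trans (C×D.≈ᴹ-sym z≈w) z≈Fx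
        ; 0-closed  = M.0ᴹ , C×D.≈ᴹ-sym (0-homo pairing)
        ; +-closed  = λ (x , z≈Fx) (y , w≈Fy) →
            x M.+ᴹ y , C×D.≈ᴹ-trans (C×D.+ᴹ-cong z≈Fx w≈Fy) (C×D.≈ᴹ-sym (+-homo pairing x y))
        ; *ₗ-closed = λ r (x , z≈Fx) →
            r M.*ₗ x , C×D.≈ᴹ-trans (C×D.*ₗ-congˡ z≈Fx)
              (C.≈ᴹ-sym (S.*-homo r x) , D.≈ᴹ-sym (T.*-homo r x))
        }

      pushout : LeftModule R a a
      pushout = C×D /ᴹ range
      private module P = LeftModule pushout

      negation : AdditiveMap T.target T.target
      negation = record
        { fun    = D.-ᴹ_
        ; cong   = D.-ᴹ‿cong
        ; +-homo = λ x y → D.≈ᴹ-sym (⁻¹-∙-comm x y)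
        }
        where open ModuleProperties T.target

      inlᴾ : AdditiveMap S.target pushout
      inlᴾ = quotientMap C×D range ∘ᴬ inl

      -- With this sign, the submodule to divide by is the range of the pairing.
      inrᴾ : AdditiveMap T.target pushout
      inrᴾ = quotientMap C×D range ∘ᴬ inr ∘ᴬ negation

      -- Write σ and τ for `S.map` and `T.map`. The difference (σ x, 0) - (0, -τ x) is (σ x, τ x),
      -- the image of `x` under `pairing`, so it is zero in the pushout.
      legs-agree : ∀ x → fun (inrᴾ ∘ᴬ T.map) x P.≈ᴹ fun (inlᴾ ∘ᴬ S.map) x
      legs-agree x = P.≈ᴹ-sym {fun (inlᴾ ∘ᴬ S.map) x} {fun (inrᴾ ∘ᴬ T.map) x}
        ( x
        , ModuleProperties.x-0≈x S.target _
        , D.≈ᴹ-trans (D.+ᴹ-identityˡ _) (ModuleProperties.⁻¹-involutive T.target _)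
        )

      -- The map from `M` to the pushout factors through either leg, so it is a member for both `s`
      -- and `t`.
      separator-∧ : Separator (s ∧ᵗ t)
      separator-∧ = record
        { target = pushout
        ; map    = inlᴾ ∘ᴬ S.map
        -- The second coordinates to compare are 0 and `r` times 0.
        ; *-homo = λ r x → cong (quotientMap C×D range) (S.*-homo r x , D.≈ᴹ-sym (D.*ₗ-zeroʳ r))
        ; member =
            annValue-∘ inlᴾ s S.member ,
            resp (annValue pushout t) legs-agree
              (annValue-∘ inrᴾ t T.member)
        -- That `y` is killed means (σ y, 0) = (σ x, τ x) for some `x`. Then σ kills y - x and τ
        -- kills x, so y = (y - x) + x lies in the sum of the dual values.
        ; kernel = λ {y} (x , Sy-0≈Sx , 0-0≈Tx) →
            y M.+ᴹ M.-ᴹ x , x ,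
            S.kernel (C.≈ᴹ-trans (+-homo S.map y (M.-ᴹ x)) (C.≈ᴹ-trans
              (C.+ᴹ-congˡ (-‿homo S.map x))
              (PC.x≈y⇒x∙y⁻¹≈ε (C.≈ᴹ-trans (C.≈ᴹ-sym (PC.x-0≈x _)) Sy-0≈Sx)))) ,
            T.kernel (D.≈ᴹ-trans (D.≈ᴹ-sym 0-0≈Tx) (D.-ᴹ‿inverseʳ D.0ᴹ)) ,
            M.≈ᴹ-sym (ModuleProperties.//-rightDividesˡ M x y)
        }
        where module PC = ModuleProperties S.target

    separator : ∀ t → Separator t
    separator (var i)  = separator-var i
    separator (s ∨ᵗ t) = separator-∨ (separator s) (separator t)
    separator (s ∧ᵗ t) = separator-∧ (separator s) (separator t)

    -- Transfer of inclusions and identities to their duals.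

    value-dual-antitone : ∀ p q →
      (∀ C → pred (annValue C p) ⊆ pred (annValue C q)) →
      pred (value (dualᵗ q)) ⊆ pred (value (dualᵗ p))
    value-dual-antitone p q p⊆q y∈ =
      -- The separating map for `p` is also a member for `q`, so it vanishes at `y`; its kernel lies
      -- in the dual value of `p`.
      kernel (annValue-vanishes target q (p⊆q target member) _ y∈)
      where open Separator (separator p)

  -- The identity is used in `Sub (Hom M C)` at the annihilators of the `X i`, for every `C`.
  -- Passing to duals reverses inclusions, so each half of the conclusion comes from the opposite
  -- half of the hypothesis.
  dual-valid : ∀ {a} e → ((M : LeftModule R a a) → Sub M ⊨ e) →
               (M : LeftModule R a a) → Sub M ⊨ dual e
  dual-valid (p ≈ᵗ q) valid M X =
    value-dual-antitone q p (λ C → proj₂ (valid (Hom M C) _)) ,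
    value-dual-antitone p q (λ C → proj₁ (valid (Hom M C) _))
    where open Duality M X

theorem5p1 : {c ℓ : Level} (u : Level) (R : Ring c ℓ) (e : Identity) →
    ((M : LeftModule R (c ⊔ ℓ ⊔ u) (c ⊔ ℓ ⊔ u)) → Sub M ⊨ e) ⇔
    ((M : LeftModule R (c ⊔ ℓ ⊔ u) (c ⊔ ℓ ⊔ u)) → Sub M ⊨ dual e)
theorem5p1 u R e = mk⇔
  (dual-valid e)
  -- The converse is the forward direction applied to `dual e`.
  (λ valid M → subst (Sub M ⊨_) (dual-involutive e) (dual-valid (dual e) valid M))
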